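{- Let $n\geq 1$ and let $\alpha$ be a permutation of $[n]=\{1,\dots,n\}$. Then $$\max_{\gamma}\{|C(\alpha \gamma)-C(\gamma)|\}=n-C(\alpha),$$ where $\gamma$ ranges over all permutations of $[n]$.
   Context: $C(\pi)$ denotes the number of cycles in the disjoint cycle decomposition of a permutation $\pi$ (fixed points count as cycles). Products of permutations are compositions of maps. -}

module Defs where

open import Data.Bool.Base using (if_then_else_)
open import Data.Empty using (⊥)
open import Data.Fin.Base using (Fin; toℕ)
import Data.Fin.Properties as Fin
open import Data.Fin.Permutation using (Permutation′; _⟨$⟩ʳ_)
open import Data.List.Base
  using (List; []; _∷_; _∷ʳ_; _++_; length; concat; foldr; allFin)
import Data.List.Properties as List
open import Data.List.Membership.Propositional using (_∈_; _∉_)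
open import Data.List.Membership.Propositional.Properties
  using (∈-++⁺ˡ; ∈-++⁺ʳ; ∈-++⁻; ∈-allFin; ∈-concat⁺′; ∈-concat⁻′)
open import Data.List.Membership.Propositional.Properties.WithK
  using (unique∧set⇒bag)
open import Data.List.Relation.Binary.BagAndSetEquality using (∼bag⇒↭)
open import Data.List.Relation.Binary.Permutation.Propositional using (_↭_)
open import Data.List.Relation.Binary.Permutation.Propositional.Properties
  using (↭-length)
open import Data.List.Relation.Unary.All as All using (All; []; _∷_)
open import Data.List.Relation.Unary.All.Properties using (¬Any⇒All¬)
open import Data.List.Relation.Unary.Any using (here; there)
open import Data.List.Relation.Unary.AllPairs using ([]; _∷_)
open import Data.List.Relation.Unary.Linked using (Linked; [-]; _∷_)
open import Data.List.Relation.Unary.Unique.Propositional using (Unique)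
open import Data.List.Relation.Unary.Unique.Propositional.Properties
  using (++⁺; allFin⁺)
open import Data.Nat.Base
open import Data.Nat.GeneralisedArithmetic using (fold; fold-+)
open import Data.Nat.Properties
open import Data.Product.Base using (_×_; _,_; ∃; proj₁; proj₂)
open import Data.Sum.Base using (inj₁; inj₂)
open import Function.Base using (_∘_)
open import Function.Bundles using (Injection; mk⇔)
open import Function.Properties.Inverse using (↔⇒↣)
open import Relation.Binary.PropositionalEquality
open import Relation.Nullary using (does; yes; no; contradiction)

module _ {n : ℕ} where
  open import Data.List.Membership.DecPropositional (Fin._≟_ {n}) using (_∈?_)

  -- x ∷ xs stands for the cycle (x π(x) π²(x) …).  Appending x to the list
  -- includes the closing step, from the last entry back to x.
  IsCycle : Permutation′ n → List (Fin n) → Set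
  IsCycle π []       = ⊥
  IsCycle π (x ∷ xs) =
    Unique (x ∷ xs) × Linked (λ i j → π ⟨$⟩ʳ i ≡ j) (x ∷ (xs ∷ʳ x))

  -- Disjointness of the cycles is part of `partition`, as allFin n has no
  -- repetitions.  Fixed points must appear, as cycles of length one.
  record IsCycleDecomposition (π : Permutation′ n)
                              (cs : List (List (Fin n))) : Set where
    field
      areCycles : All (IsCycle π) cs
      partition : concat cs ↭ allFin n

  -- π(x), π²(x), … up to, and excluding, the first occurrence of x₀; at most
  -- k entries.
  orbitUntil : Permutation′ n → Fin n → ℕ → Fin n → List (Fin n)
  orbitUntil π x₀ zero    x = []
  orbitUntil π x₀ (suc k) x =
    if does (π ⟨$⟩ʳ x Fin.≟ x₀) then []
    else (π ⟨$⟩ʳ x) ∷ orbitUntil π x₀ k (π ⟨$⟩ʳ x)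

  cycleOf : Permutation′ n → Fin n → List (Fin n)
  cycleOf π x = x ∷ orbitUntil π x n x

  addCycle : Permutation′ n → Fin n → List (List (Fin n)) → List (List (Fin n))
  addCycle π x cs = if does (x ∈? concat cs) then cs else cycleOf π x ∷ cs

  cycles : Permutation′ n → List (List (Fin n))
  cycles π = foldr (addCycle π) [] (allFin n)

  C : Permutation′ n → ℕ
  C π = length (cycles π)

IsMaximum : {A : Set} → (A → ℕ) → ℕ → Set
IsMaximum f m = (∃ λ a → f a ≡ m) × (∀ a → f a ≤ m)

module _ {n : ℕ} (π : Permutation′ n) where
  open import Data.List.Membership.DecPropositional (Fin._≟_ {n}) using (_∈?_)

  private
    p : Fin n → Fin n
    p = π ⟨$⟩ʳ_

    Step : Fin n → Fin n → Set
    Step i j = p i ≡ j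

    p-injective : ∀ {i j} → p i ≡ p j → i ≡ j
    p-injective = Injection.injective (↔⇒↣ π)

    fold-injective : ∀ k {i j} → fold i p k ≡ fold j p k → i ≡ j
    fold-injective zero    eq = eq
    fold-injective (suc k) eq = fold-injective k (p-injective eq)

    fold-suc : ∀ k {i} → fold i p (suc k) ≡ fold (p i) p k
    fold-suc zero    = refl
    fold-suc (suc k) = cong p (fold-suc k)

    difference : ∀ {a b} → a < b → ∃ λ o → a + suc o ≡ b
    difference {a} a<b with o , eq ← m≤n⇒∃[o]m+o≡n a<b =
      o , trans (+-suc a o) eq

    returns : ∀ x → ∃ λ d → d < n × fold x p (suc d) ≡ x
    returns x
      with i , j , i<j , eq ← Fin.pigeonhole (n<1+n n) (fold x p ∘ toℕ {suc n})
      with d , j≡ ← difference i<j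
      = d
      , ≤-trans (m≤n+m (suc d) (toℕ i))
                (≤-trans (≤-reflexive j≡) (s≤s⁻¹ (Fin.toℕ<n j)))
      , sym (fold-injective (toℕ i) (begin
          fold x p (toℕ i)                   ≡⟨ eq ⟩
          fold x p (toℕ j)                   ≡⟨ cong (fold x p) j≡ ⟨
          fold x p (toℕ i + suc d)           ≡⟨ fold-+ x p (toℕ i) ⟩
          fold (fold x p (suc d)) p (toℕ i)  ∎))
      where open ≡-Reasoning

    data Until (x₀ : Fin n) (x : Fin n) : List (Fin n) → Set where
      stop : p x ≡ x₀ → Until x₀ x []
      step : ∀ {ys} → p x ≢ x₀ → Until x₀ (p x) ys → Until x₀ x (p x ∷ ys)

    orbit-until : ∀ {x₀} k {x} d → d < k → fold x p (suc d) ≡ x₀ →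
                  Until x₀ x (orbitUntil π x₀ k x)
    orbit-until {x₀} (suc k) {x} d d<k eq with p x Fin.≟ x₀
    ... | yes px≡x₀ = stop px≡x₀
    orbit-until (suc k) zero    d<k eq | no px≢x₀ = contradiction eq px≢x₀
    orbit-until (suc k) (suc d) d<k eq | no px≢x₀ =
      step px≢x₀ (orbit-until k d (s≤s⁻¹ d<k) (trans (sym (fold-suc (suc d))) eq))

    module _ {x₀ : Fin n} where

      until-functional : ∀ {x ys zs} → Until x₀ x ys → Until x₀ x zs → ys ≡ zs
      until-functional (stop _)    (stop _)    = refl
      until-functional (stop eq)   (step ne _) = contradiction eq ne
      until-functional (step ne _) (stop eq)   = contradiction eq ne
      until-functional (step _ u)  (step _ v)  = cong (_ ∷_) (until-functional u v)

      until-suffix : ∀ {x ys z} → Until x₀ x ys → z ∈ ys →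
                     ∃ λ zs → Until x₀ z zs × length zs < length ys
      until-suffix (step _ u) (here refl) = _ , u , n<1+n _
      until-suffix (step _ u) (there z∈)
        with zs , v , lt ← until-suffix u z∈ = zs , v , m<n⇒m<1+n lt

      until-∉ : ∀ {x ys} → Until x₀ x ys → x ∉ ys
      until-∉ u x∈ with zs , v , lt ← until-suffix u x∈ =
        <-irrefl (cong length (until-functional v u)) lt

      until-unique : ∀ {x ys} → Until x₀ x ys → Unique (x ∷ ys)
      until-unique u@(stop _)   = ¬Any⇒All¬ _ (until-∉ u) ∷ []
      until-unique u@(step _ v) = ¬Any⇒All¬ _ (until-∉ u) ∷ until-unique v

      until-linked : ∀ {x ys} → Until x₀ x ys → Linked Step (x ∷ (ys ∷ʳ x₀))
      until-linked (stop eq)  = eq ∷ [-]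
      until-linked (step _ u) = refl ∷ until-linked u

      until-reaches : (P : Fin n → Set) → (∀ {i} → P i → P (p i)) →
                      ∀ {x ys z} → Until x₀ x ys → z ∈ x ∷ ys → P z → P x₀
      until-reaches P cl (stop eq)  (here refl) Pz = subst P eq (cl Pz)
      until-reaches P cl (step _ u) (here refl) Pz =
        until-reaches P cl u (here refl) (cl Pz)
      until-reaches P cl (step _ u) (there z∈)  Pz = until-reaches P cl u z∈ Pz

    until-cycleOf : ∀ x → Until x x (orbitUntil π x n x)
    until-cycleOf x with d , d<n , eq ← returns x = orbit-until n d d<n eq

    linked-next : ∀ {x₀ z} x xs → Linked Step (x ∷ (xs ∷ʳ x₀)) → z ∈ x ∷ xs →
                  p z ∈ xs ∷ʳ x₀
    linked-next x []       (eq ∷ _) (here refl) = here eq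
    linked-next x (y ∷ ys) (eq ∷ _) (here refl) = here eq
    linked-next x (y ∷ ys) (_ ∷ l)  (there z∈)  = there (linked-next y ys l z∈)

    cycle-closed : ∀ {c z} → IsCycle π c → z ∈ c → p z ∈ c
    cycle-closed {x ∷ xs} (_ , l) z∈ with ∈-++⁻ xs (linked-next x xs l z∈)
    ... | inj₁ pz∈        = there pz∈
    ... | inj₂ (here eq)  = here eq

    concat-closed : ∀ {cs z} → All (IsCycle π) cs → z ∈ concat cs → p z ∈ concat cs
    concat-closed {cs} cyc z∈ with c , z∈c , c∈cs ← ∈-concat⁻′ cs z∈ =
      ∈-concat⁺′ (cycle-closed (All.lookup cyc c∈cs) z∈c) c∈cs

    record Partial (is : List (Fin n)) (cs : List (List (Fin n))) : Set where
      field
        areCycles : All (IsCycle π) cs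
        unique    : Unique (concat cs)
        covers    : ∀ {i} → i ∈ is → i ∈ concat cs

    partial : ∀ is → Partial is (foldr (addCycle π) [] is)
    partial []       = record { areCycles = [] ; unique = [] ; covers = λ () }
    partial (x ∷ is) with foldr (addCycle π) [] is | partial is
    ... | cs | ih with x ∈? concat cs
    ...   | yes x∈ = record
      { areCycles = areCycles
      ; unique    = unique
      ; covers    = λ { (here refl) → x∈ ; (there i∈) → covers i∈ }
      } where open Partial ih
    ...   | no x∉ = record
      { areCycles = (until-unique u , until-linked u) ∷ areCycles
      ; unique    = ++⁺ (until-unique u) unique λ (z∈c , z∈cs) →
          x∉ (until-reaches (_∈ concat cs) (concat-closed areCycles) u z∈c z∈cs)
      ; covers    = λ { (here refl) → here refl
                      ; (there i∈)  → ∈-++⁺ʳ (cycleOf π x) (covers i∈) }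
      } where
        open Partial ih
        u = until-cycleOf x

  cycles-isCycleDecomposition : IsCycleDecomposition π (cycles π)
  cycles-isCycleDecomposition = record
    { areCycles = areCycles
    ; partition = ∼bag⇒↭ (unique∧set⇒bag unique (allFin⁺ n)
        (mk⇔ (λ _ → ∈-allFin _) (λ _ → covers (∈-allFin _))))
    } where open Partial (partial (allFin n))

  C≤n : C π ≤ n
  C≤n = begin
    length (cycles π)           ≤⟨ length≤length-concat areCycles ⟩
    length (concat (cycles π))  ≡⟨ ↭-length partition ⟩
    length (allFin n)           ≡⟨ List.length-tabulate _ ⟩
    n                           ∎
    where
    open ≤-Reasoning
    open IsCycleDecomposition cycles-isCycleDecomposition
    length≤length-concat : ∀ {cs} → All (IsCycle π) cs →
                           length cs ≤ length (concat cs)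
    length≤length-concat []                         = z≤n
    length≤length-concat {(x ∷ xs) ∷ cs} (_ ∷ cyc)  = s≤s (begin
      length cs                       ≤⟨ length≤length-concat cyc ⟩
      length (concat cs)              ≤⟨ m≤n+m _ (length xs) ⟩
      length xs + length (concat cs)  ≡⟨ List.length-++ xs ⟨
      length (xs ++ concat cs)        ∎)

-- Contract the edges of a graph on [n] one at a time, recording for each vertex
-- the vertex that represents it: each edge loses at most one representative, so
-- a graph with e edges has at least n − e components.  A cycle of length ℓ is
-- connected by ℓ − 1 edges, hence a permutation π by n − C(π) edges.  If two of
-- α, γ and αγ respect the components of a graph, so does the third; connecting
-- two of them by such edges therefore bounds the cycle count of the third from
-- below by n minus the number of edges.  The maximum is attained at γ = id.
module Submission where

open import Defs
open import Data.Nat.Base using (ℕ; suc; _+_; _≤_; _∸_; ∣_-_∣)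
open import Data.Nat.Properties
open import Data.Fin.Base using (Fin)
import Data.Fin.Properties as Fin
open import Data.Fin.Permutation using (Permutation′; _∘ₚ_; _⟨$⟩ʳ_; id)
open import Data.List.Base
  using (List; []; _∷_; _∷ʳ_; _++_; length; concat; map; lookup; allFin)
import Data.List.Properties as List
open import Data.List.Membership.Propositional using (_∈_)
open import Data.List.Membership.Propositional.Properties
  using (∈-++⁺ˡ; ∈-++⁺ʳ; ∈-++⁻; ∈-allFin; ∈-map⁺; ∈-concat⁻′)
open import Data.List.Relation.Binary.Permutation.Propositional using (↭-sym)
open import Data.List.Relation.Binary.Permutation.Propositional.Properties
  using (↭-length; ∈-resp-↭)
open import Data.List.Relation.Binary.Subset.Propositional using (_⊆_)
open import Data.List.Relation.Binary.Subset.Propositional.Properties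
  using (xs⊆xs++ys; xs⊆ys++xs)
open import Data.List.Relation.Unary.All as All using (All; []; _∷_)
open import Data.List.Relation.Unary.Any using (here; there; index)
open import Data.List.Relation.Unary.Any.Properties using (lookup-index)
open import Data.List.Relation.Unary.Linked using (Linked; _∷_)
open import Data.Product.Base using (_×_; _,_; ∃)
open import Data.Sum.Base using (inj₁; inj₂)
open import Function.Base using (_∘_; case_of_)
open import Relation.Binary.PropositionalEquality
open import Relation.Nullary using (yes; no; contradiction)

-- The position of `i` in `xs` determines `i`, so `index` gives an injection into the positions.
covering⇒≤length : ∀ {n} {xs : List (Fin n)} → (∀ i → i ∈ xs) → n ≤ length xs
covering⇒≤length {xs = xs} i∈xs = Fin.injective⇒≤ {f = index ∘ i∈xs} λ {i} {j} eq →
  begin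
    i                            ≡⟨ lookup-index (i∈xs i) ⟩
    lookup xs (index (i∈xs i))   ≡⟨ cong (lookup xs) eq ⟩
    lookup xs (index (i∈xs j))   ≡⟨ lookup-index (i∈xs j) ⟨
    j                            ∎
  where open ≡-Reasoning

module _ {n : ℕ} where

  Edges : Set
  Edges = List (Fin n × Fin n)

  merge : Fin n → Fin n → Fin n → Fin n
  merge a b x with x Fin.≟ a
  ... | yes _ = b
  ... | no  _ = x

  -- The head edge is contracted last. If its ends already share a representative, `merge` changes
  -- nothing.
  rep : Edges → Fin n → Fin n
  rep []            x = x
  rep ((a , b) ∷ E) x = merge (rep E a) (rep E b) (rep E x)

  merge-joins : ∀ a b → merge a b a ≡ merge a b b
  merge-joins a b with a Fin.≟ a | b Fin.≟ a
  ... | yes _   | yes _ = refl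
  ... | yes _   | no  _ = refl
  ... | no  a≢a | _     = contradiction refl a≢a

  rep-joins : ∀ {E a b} → (a , b) ∈ E → rep E a ≡ rep E b
  rep-joins {(a , b) ∷ E} (here refl) = merge-joins (rep E a) (rep E b)
  rep-joins {(a , b) ∷ E} (there e∈E) =
    cong (merge (rep E a) (rep E b)) (rep-joins e∈E)

  merge-∈ : ∀ {a b x xs} → merge a b x ∈ xs → x ∈ a ∷ xs
  merge-∈ {a} {b} {x} m∈ with x Fin.≟ a
  ... | yes x≡a = here x≡a
  ... | no  _   = there m∈

  -- Undoing the contraction of an edge restores at most one representative, `rep E a`. The list
  -- `xs` is arbitrary so that it can gain this entry as the edge is removed.
  n≤edges+reps : ∀ E {xs} → (∀ x → rep E x ∈ xs) → n ≤ length E + length xs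
  n≤edges+reps []            rep∈ = covering⇒≤length rep∈
  n≤edges+reps ((a , b) ∷ E) {xs} rep∈ =
    subst (n ≤_) (+-suc (length E) (length xs))
      (n≤edges+reps E (merge-∈ ∘ rep∈))

  -- That is, `f` is constant on the cycles of `π`; for `rep E`, each cycle lies within one
  -- component.
  Invariant : (Fin n → Fin n) → Permutation′ n → Set
  Invariant f π = ∀ i → f (π ⟨$⟩ʳ i) ≡ f i

  -- A star rather than a path, so that a single use of `rep-joins` compares any entry with the
  -- first.
  star : List (Fin n) → Edges
  star []       = []
  star (x ∷ xs) = map (x ,_) xs

  forest : List (List (Fin n)) → Edges
  forest []       = []
  forest (c ∷ cs) = star c ++ forest cs

  star⊆forest : ∀ {c cs} → c ∈ cs → star c ⊆ forest cs
  star⊆forest (here refl) = ∈-++⁺ˡ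
  star⊆forest {cs = c ∷ _} (there c∈) = ∈-++⁺ʳ (star c) ∘ star⊆forest c∈

  module _ (π : Permutation′ n) where
    open IsCycleDecomposition (cycles-isCycleDecomposition π)

    private
      Step : Fin n → Fin n → Set
      Step i j = π ⟨$⟩ʳ i ≡ j

    linked-next : ∀ {z i} x xs → Linked Step (x ∷ (xs ∷ʳ z)) → i ∈ x ∷ xs →
                  π ⟨$⟩ʳ i ∈ xs ∷ʳ z
    linked-next x []       (eq ∷ _) (here refl) = here eq
    linked-next x (y ∷ ys) (eq ∷ _) (here refl) = here eq
    linked-next x (y ∷ ys) (_ ∷ l)  (there i∈)  = there (linked-next y ys l i∈)

    linked-invariant : ∀ {f z} → Invariant f π → ∀ x xs →
      Linked Step (x ∷ (xs ∷ʳ z)) → ∀ {i} → i ∈ x ∷ xs → f i ≡ f x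
    linked-invariant inv x xs       l          (here refl) = refl
    linked-invariant {f} inv x (y ∷ ys) (eq ∷ l) (there i∈) =
      trans (linked-invariant inv y ys l i∈) (trans (cong f (sym eq)) (inv x))

    inCycle : ∀ i → ∃ λ c → i ∈ c × c ∈ cycles π
    inCycle i = ∈-concat⁻′ (cycles π) (∈-resp-↭ (↭-sym partition) (∈-allFin i))

    star-invariant : ∀ {E c} → IsCycle π c → star c ⊆ E → ∀ {i} → i ∈ c →
                     rep E (π ⟨$⟩ʳ i) ≡ rep E i
    star-invariant {E} {x ∷ xs} (_ , l) star⊆E i∈ =
      trans (to-centre (case ∈-++⁻ xs (linked-next x xs l i∈) of λ
              { (inj₁ πi∈)       → there πi∈
              ; (inj₂ (here eq)) → here eq }))
            (sym (to-centre i∈))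
      where
      to-centre : ∀ {j} → j ∈ x ∷ xs → rep E j ≡ rep E x
      to-centre (here refl) = refl
      to-centre (there j∈)  = sym (rep-joins (star⊆E (∈-map⁺ (x ,_) j∈)))

    -- Any larger `E` is allowed, so that the union of two forests serves two permutations at once.
    forest-invariant : ∀ {E} → forest (cycles π) ⊆ E → Invariant (rep E) π
    forest-invariant ⊆E i with c , i∈c , c∈cs ← inCycle i =
      star-invariant (All.lookup areCycles c∈cs) (⊆E ∘ star⊆forest c∈cs) i∈c

    length-forest : length (forest (cycles π)) ≡ n ∸ C π
    length-forest = begin
      length (forest (cycles π))              ≡⟨ m+n∸n≡m _ (C π) ⟨
      length (forest (cycles π)) + C π ∸ C π  ≡⟨ cong (_∸ C π) (edges+cycles areCycles) ⟩
      length (concat (cycles π)) ∸ C π        ≡⟨ cong (_∸ C π) (↭-length partition) ⟩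
      length (allFin n) ∸ C π                 ≡⟨ cong (_∸ C π) (List.length-tabulate _) ⟩
      n ∸ C π                                 ∎
      where
      open ≡-Reasoning
      -- The star of a cycle has one edge fewer than the cycle has entries; counting the cycle
      -- itself makes up for it.
      edges+cycles : ∀ {cs} → All (IsCycle π) cs →
                    length (forest cs) + length cs ≡ length (concat cs)
      edges+cycles []                            = refl
      edges+cycles {(x ∷ xs) ∷ cs} (_ ∷ areCycs) = begin
        length (map (x ,_) xs ++ forest cs) + suc (length cs)
          ≡⟨ +-suc _ (length cs) ⟩
        suc (length (map (x ,_) xs ++ forest cs) + length cs)
          ≡⟨ cong (λ k → suc (k + length cs)) (List.length-++ (map (x ,_) xs)) ⟩
        suc (length (map (x ,_) xs) + length (forest cs) + length cs)
          ≡⟨ cong (λ k → suc (k + length (forest cs) + length cs)) (List.length-map _ xs) ⟩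
        suc (length xs + length (forest cs) + length cs)
          ≡⟨ cong suc (+-assoc (length xs) _ _) ⟩
        suc (length xs + (length (forest cs) + length cs))
          ≡⟨ cong (λ k → suc (length xs + k)) (edges+cycles areCycs) ⟩
        suc (length xs + length (concat cs))
          ≡⟨ cong suc (List.length-++ xs) ⟨
        suc (length (xs ++ concat cs))
          ∎

    -- The value of `f` at the first entry of a cycle is its value on the whole cycle.
    cycle-labels : ∀ {f cs} → Invariant f π → All (IsCycle π) cs →
      ∃ λ ls → length ls ≡ length cs × (∀ {i} → i ∈ concat cs → f i ∈ ls)
    cycle-labels inv [] = [] , refl , λ ()
    cycle-labels {f} {(x ∷ xs) ∷ _} inv ((_ , l) ∷ areCycs)
      with ls , eq , label∈ ← cycle-labels {f} inv areCycs =
      f x ∷ ls , cong suc eq , λ i∈ → case ∈-++⁻ (x ∷ xs) i∈ of λ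
        { (inj₁ i∈c)  → here (linked-invariant inv x xs l i∈c)
        ; (inj₂ i∈cs) → there (label∈ i∈cs) }

    n≤edges+C : ∀ E → Invariant (rep E) π → n ≤ length E + C π
    n≤edges+C E inv with ls , eq , label∈ ← cycle-labels inv areCycles =
      subst (λ k → n ≤ length E + k) eq
        (n≤edges+reps E λ x → label∈ (∈-resp-↭ (↭-sym partition) (∈-allFin x)))

  -- The hypothesis holds whenever `σ` is a product of `π`, `ρ` and their inverses.
  C-bound : ∀ {π ρ σ} →
            (∀ {f} → Invariant f π → Invariant f ρ → Invariant f σ) →
            C ρ ≤ (n ∸ C π) + C σ
  -- Adding `n ∸ C ρ` turns the left side into `n` and completes the edge count of both forests on
  -- the right.
  C-bound {π} {ρ} {σ} inv = +-cancelˡ-≤ (n ∸ C ρ) _ _ (begin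
    (n ∸ C ρ) + C ρ               ≡⟨ m∸n+n≡m (C≤n ρ) ⟩
    n                             ≤⟨ n≤edges+C σ (E ++ F) (inv
                                       (forest-invariant π (xs⊆xs++ys E F))
                                       (forest-invariant ρ (xs⊆ys++xs F E))) ⟩
    length (E ++ F) + C σ         ≡⟨ cong (_+ C σ) (List.length-++ E) ⟩
    length E + length F + C σ     ≡⟨ cong₂ (λ k l → k + l + C σ)
                                       (length-forest π) (length-forest ρ) ⟩
    (n ∸ C π) + (n ∸ C ρ) + C σ   ≡⟨ cong (_+ C σ) (+-comm (n ∸ C π) (n ∸ C ρ)) ⟩
    (n ∸ C ρ) + (n ∸ C π) + C σ   ≡⟨ +-assoc (n ∸ C ρ) (n ∸ C π) (C σ) ⟩
    (n ∸ C ρ) + ((n ∸ C π) + C σ) ∎)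
    where
    open ≤-Reasoning
    E = forest (cycles π)
    F = forest (cycles ρ)

  C-id : C (id {n}) ≡ n
  C-id = ≤-antisym (C≤n id) (n≤edges+C id [] λ _ → refl)

  -- Permutations with the same underlying map may differ as records, but they have the same
  -- invariants.
  C-cong : ∀ {π ρ} → (∀ i → π ⟨$⟩ʳ i ≡ ρ ⟨$⟩ʳ i) → C π ≡ C ρ
  C-cong {π} {ρ} π≗ρ = ≤-antisym
    (C-mono λ {f} inv i → trans (cong f (sym (π≗ρ i))) (inv i))
    (C-mono λ {f} inv i → trans (cong f (π≗ρ i)) (inv i))
    where
    C-mono : ∀ {σ τ} → (∀ {f} → Invariant f σ → Invariant f τ) → C σ ≤ C τ
    C-mono {σ} {τ} inv =
      -- The forest of `id` has no edges, so the error term in `C-bound` vanishes.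
      subst (λ k → C σ ≤ k + C τ) (trans (cong (n ∸_) C-id) (n∸n≡0 n))
        (C-bound {id} {σ} {τ} λ _ → inv)

∣m-n∣≤o : ∀ {m n o} → m ≤ o + n → n ≤ o + m → ∣ m - n ∣ ≤ o
∣m-n∣≤o {m} {n} {o} m≤o+n n≤o+m with ∣m-n∣≡[m∸n]∨[n∸m] m n
... | inj₁ eq = ≤-trans (≤-reflexive eq) (m≤n+o⇒m∸n≤o m n (subst (m ≤_) (+-comm o n) m≤o+n))
... | inj₂ eq = ≤-trans (≤-reflexive eq) (m≤n+o⇒m∸n≤o n m (subst (n ≤_) (+-comm o m) n≤o+m))

theorem6 : (n : ℕ) → 1 ≤ n → (α : Permutation′ n) →
    IsMaximum (λ (γ : Permutation′ n) → ∣ C (γ ∘ₚ α) - C γ ∣) (n ∸ C α)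
theorem6 n _ α = (id , attained) , λ γ → ∣m-n∣≤o
    -- `γ ∘ₚ α` applies `γ` first. Here `γ` is recovered from `α` and the product:
    -- `f (γ i) = f (α (γ i)) = f i`.
    (C-bound {n} {α} {γ ∘ₚ α} {γ} λ invα invγα i →
      trans (sym (invα (γ ⟨$⟩ʳ i))) (invγα i))
    (C-bound {n} {α} {γ} {γ ∘ₚ α} λ invα invγ i →
      trans (invα (γ ⟨$⟩ʳ i)) (invγ i))
  where
  open ≡-Reasoning
  attained : ∣ C (id ∘ₚ α) - C (id {n}) ∣ ≡ n ∸ C α
  attained = begin
    ∣ C (id ∘ₚ α) - C (id {n}) ∣  ≡⟨ cong₂ ∣_-_∣ (C-cong {n} {id ∘ₚ α} {α} λ _ → refl) C-id ⟩
    ∣ C α - n ∣                   ≡⟨ m≤n⇒∣m-n∣≡n∸m (C≤n α) ⟩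
    n ∸ C α                       ∎
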